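{- Let $n\ge 1$ be an integer and let $G$ be a simple graph. Then $G$ is isomorphic to the complete graph $K_n$ if and only if $$da(G;x,y) = \frac{(1+xy^{2})^{n}-1}{y}\qquad (y\ne 0).$$
   Context: All graphs are finite, simple and have at least one vertex. For a graph $G$, $S\subseteq V(G)$ and $u\in V(G)$, let $\bar S=V(G)\setminus S$, let $\delta_S(u)=|\{v\in S:\{u,v\}\in E(G)\}|$, and let $G[S]$ be the subgraph induced by $S$. The defensive alliance polynomial of $G$ is $$da(G;x,y)=\sum_{S} x^{|S|}\,y^{f_y(S)},\qquad f_y(S)=\min_{u\in S}\bigl(\delta_S(u)-\delta_{\bar S}(u)+|V(G)|\bigr),$$ where the sum runs over all non-empty $S\subseteq V(G)$ such that $G[S]$ is connected (single-vertex graphs are connected). The equality is an identity of functions of $x,y$ (equivalently, of rational functions in $x,y$). -}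

module Defs where

open import Algebra.Apartness.Bundles using (HeytingField; HeytingCommutativeRing)
open import Algebra.Bundles using (CommutativeRing; Semiring)
open import Data.Fin.Base using (Fin)
open import Data.Fin.Properties using (_≟_; any?; all?)
open import Data.Fin.Subset
  using (Subset; inside; outside; _∈_; _⊃_; _∪_; _∩_; ∁; ⁅_⁆; ∣_∣; Nonempty)
open import Data.Fin.Subset.Induction using (⊃-wellFounded; Acc; acc)
open import Data.Fin.Subset.Properties
  using (_∈?_; nonempty?; p⊆p∪q; q⊆p∪q; x∈p∪q⁻; x∈⁅x⁆; x∈⁅y⁆⇒x≡y)
open import Data.List.Base as List using (List; []; _∷_; _++_; filter; foldr)
open import Data.List.Extrema.Nat using (min)
open import Data.Nat.Base using (ℕ; zero; suc; _+_; _∸_; NonZero)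
open import Data.Product.Base using (Σ-syntax; _×_; _,_; proj₁)
open import Data.Sum.Base using (inj₁; inj₂)
open import Data.Vec.Base as Vec using (tabulate)
open import Function.Base using (_∘_)
open import Function.Bundles using (_↔_; _⇔_; Inverse)
open import Level using (0ℓ)
open import Relation.Binary.Construct.Closure.ReflexiveTransitive using (Star; ε; _◅_; _◅◅_)
open import Relation.Binary.Core using (Rel)
open import Relation.Binary.Definitions using (Decidable; Symmetric; Irreflexive)
open import Relation.Binary.PropositionalEquality using (_≡_; _≢_; refl; sym)
open import Relation.Nullary using (Dec; yes; no; does; ¬?; _×-dec_; _→-dec_)
open import Relation.Nullary.Decidable using (map′; decidable-stable)

record Graph : Set₁ where
  infix 4 _~_ _~?_
  field
    order             : ℕ
    .{{order-nonZero}} : NonZero order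
    _~_               : Rel (Fin order) 0ℓ
    _~?_              : Decidable _~_
    ~-sym             : Symmetric _~_
    ~-irrefl          : Irreflexive _≡_ _~_

  Vertex : Set
  Vertex = Fin order

infix 4 _≅_

record _≅_ (G H : Graph) : Set where
  private
    module G = Graph G
    module H = Graph H
  field
    bijection : G.Vertex ↔ H.Vertex
    adjacency : ∀ u v → u G.~ v ⇔ Inverse.to bijection u H.~ Inverse.to bijection v

K : ∀ n .{{_ : NonZero n}} → Graph
K n = record
  { order    = n
  ; _~_      = _≢_
  ; _~?_     = λ u v → ¬? (u ≟ v)
  ; ~-sym    = _∘ sym
  ; ~-irrefl = λ u≡v u≢v → u≢v u≡v
  }

-- Reachability along a decidable relation on a finite set is decidable:
-- starting from ⁅ u ⁆, add successors until the set is closed.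

module _ {n} {R : Rel (Fin n) 0ℓ} (R? : Decidable R) where

  private
    Closed : Subset n → Set
    Closed T = ∀ {a b} → a ∈ T → R a b → b ∈ T

    saturate : ∀ u T → Acc _⊃_ T → u ∈ T → (∀ {v} → v ∈ T → Star R u v) →
               Σ[ T′ ∈ Subset n ] u ∈ T′ × Closed T′ × (∀ {v} → v ∈ T′ → Star R u v)
    saturate u T (acc rec) u∈T reached
      with any? (λ a → a ∈? T ×-dec any? (λ b → ¬? (b ∈? T) ×-dec R? a b))
    ... | no ¬exit = T , u∈T , closed , reached
      where
      closed : Closed T
      closed {a} {b} a∈T aRb =
        decidable-stable (b ∈? T) λ b∉T → ¬exit (a , a∈T , b , b∉T , aRb)
    ... | yes (a , a∈T , b , b∉T , aRb) =
      saturate u (T ∪ ⁅ b ⁆)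
        (rec (p⊆p∪q ⁅ b ⁆ , b , q⊆p∪q T ⁅ b ⁆ (x∈⁅x⁆ b) , b∉T))
        (p⊆p∪q ⁅ b ⁆ u∈T) reached′
      where
      reached′ : ∀ {v} → v ∈ T ∪ ⁅ b ⁆ → Star R u v
      reached′ v∈ with x∈p∪q⁻ T ⁅ b ⁆ v∈
      ... | inj₁ v∈T = reached v∈T
      ... | inj₂ v∈b with refl ← x∈⁅y⁆⇒x≡y b v∈b = reached a∈T ◅◅ (aRb ◅ ε)

    closed⇒reachable∈ : ∀ {T u v} → Closed T → u ∈ T → Star R u v → v ∈ T
    closed⇒reachable∈ closed u∈T ε          = u∈T
    closed⇒reachable∈ closed u∈T (uRw ◅ wv) =
      closed⇒reachable∈ closed (closed u∈T uRw) wv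

    ≡⇒reachable : ∀ {u v} → u ≡ v → Star R u v
    ≡⇒reachable refl = ε

  star? : Decidable (Star R)
  star? u v
    with T , u∈T , closed , reached ←
      saturate u ⁅ u ⁆ (⊃-wellFounded ⁅ u ⁆) (x∈⁅x⁆ u)
        (λ v∈u → ≡⇒reachable (sym (x∈⁅y⁆⇒x≡y u v∈u)))
    = map′ reached (closed⇒reachable∈ closed u∈T) (v ∈? T)

subsets : ∀ n → List (Subset n)
subsets zero    = Vec.[] ∷ []
subsets (suc n) =
  List.map (outside Vec.∷_) (subsets n) ++ List.map (inside Vec.∷_) (subsets n)

module _ (G : Graph) where
  open Graph G

  -- Adjacency in the induced subgraph G[S], whose vertices are the elements of S.
  Induced : Subset order → Rel Vertex 0ℓ
  Induced S u v = u ∈ S × v ∈ S × u ~ v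

  -- Every two vertices of G[S] are joined by a walk in G[S].
  InducedConnected : Subset order → Set
  InducedConnected S = ∀ u v → u ∈ S → v ∈ S → Star (Induced S) u v

  inducedConnected? : ∀ S → Dec (InducedConnected S)
  inducedConnected? S = all? λ u → all? λ v →
    u ∈? S →-dec (v ∈? S →-dec
      star? (λ a b → a ∈? S ×-dec (b ∈? S ×-dec a ~? b)) u v)

  neighbourhood : Vertex → Subset order
  neighbourhood u = tabulate λ v → does (u ~? v)

  δ : Subset order → Vertex → ℕ
  δ S u = ∣ S ∩ neighbourhood u ∣

  -- δ_S(u) - δ_S̄(u) + |V|, with the subtraction moved last.  It never
  -- truncates, since δ_S̄(u) ≤ |V|.
  score : Subset order → Vertex → ℕ
  score S u = (δ S u + order) ∸ δ (∁ S) u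

  elements : Subset order → List Vertex
  elements S = filter (_∈? S) (List.allFin order)

  -- The witness of non-emptiness only seeds the minimum; its score is one of
  -- the values the minimum ranges over anyway.
  f-y : ∀ S → Nonempty S → ℕ
  f-y S (u₀ , _) = min (score S u₀) (List.map (score S) (elements S))

module FieldNotions {c ℓ₁ ℓ₂} (F : HeytingField c ℓ₁ ℓ₂) where
  private
    module F = HeytingField F
    ring = HeytingCommutativeRing.commutativeRing F.heytingCommutativeRing

  open F using (Carrier; _#_; 0#; 1#; _*_)
  open import Algebra.Definitions.RawSemiring
    (Semiring.rawSemiring (CommutativeRing.semiring ring)) public
    using (_^_) renaming (_×_ to _·_)

  CharacteristicZero : Set ℓ₂
  CharacteristicZero = ∀ n → suc n · 1# # 0#

  infixl 7 _/_[_]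

  -- #⇒invertible inverts y - 0#, which is y up to _≈_.
  _/_[_] : Carrier → ∀ y → y # 0# → Carrier
  x / y [ y#0 ] = x * proj₁ (F.#⇒invertible y#0)

  module _ (G : Graph) (x y : Carrier) where
    open Graph G

    term : ∀ S → Dec (Nonempty S × InducedConnected G S) → Carrier
    term S (yes (S≢∅ , _)) = x ^ ∣ S ∣ * y ^ f-y G S S≢∅
    term S (no _)          = 0#

    da : Carrier
    da = foldr F._+_ 0# (List.map
      (λ S → term S (nonempty? S ×-dec inducedConnected? G S)) (subsets order))

-- In a complete graph a non-empty S is connected and every u ∈ S has score
-- 2|S| - 1, so y · da + 1 sums (xy²)^|S| over all S and equals (1 + xy²)^n.
-- Conversely, in characteristic zero the identity can be evaluated at natural
-- numbers and pulled back to ℕ.  The coefficient of x on the left of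
-- y · da = (1 + xy²)^n - 1 comes from the singletons, which gives
-- Σ_u y^s(u) = n y, where s(u) = |V| - deg u ≥ 1.  At y = 1 this says |V| = n, and
-- at y = 2 that every s(u) is 1, that is, G is complete.

module Submission where

open import Defs
open import Algebra.Apartness.Bundles using (HeytingField; HeytingCommutativeRing)
open import Algebra.Bundles using (Semiring; CommutativeRing)
import Algebra.Properties.AbelianGroup as AbelianGroupProperties
import Algebra.Properties.CommutativeSemiring.Exp as Exp
import Algebra.Properties.Semiring.Mult as Mult
open import Algebra.Properties.Semiring.Sum using (sum; sum-cong-≗; *-distribˡ-sum)
open import Data.Fin.Base using (Fin; zero; suc)
open import Data.Fin.Permutation using (↔⇒≡)
open import Data.Fin.Properties using (_≟_)
open import Data.Fin.Subset
  using (Subset; inside; outside; _∈_; _∩_; ∁; ⁅_⁆; ⊥; ∣_∣; Nonempty)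
open import Data.Fin.Subset.Properties
  using (_∈?_; nonempty?; x∈⁅x⁆; x∈⁅y⁆⇒x≡y; ∉⊥; ∣p∣≤n; ∣⁅x⁆∣≡1; ∣∁p∣≡n∸∣p∣;
         ∣p∩q∣≤∣p∣; p∩q⊆p; p∩q⊆q; p⊂q⇒∣p∣<∣q∣; x∈p∩q⁺; x∈∁p⇒x∉p; x∉p⇒x∈∁p;
         ⊆-antisym)
open import Data.List.Base as List using ([]; _∷_; _++_; foldr)
open import Data.List.Extrema.Nat using (argmin-all)
open import Data.List.Properties using (map-++; map-∘)
open import Data.List.Relation.Unary.All as All using ()
open import Data.List.Relation.Unary.All.Properties using (all-filter; map⁺)
open import Data.Nat.Base as ℕ using (ℕ; zero; suc; NonZero; _≤_; _<_; _∸_; z≤n; s≤s)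
open import Data.Nat.Divisibility using (_∣_; divides; ∣-trans; m∣m*n; _∣0)
open import Data.Nat.DivMod using (_%_; [m+kn]%n≡m%n; m<n⇒m%n≡m)
import Data.Nat.Properties as ℕ
open import Data.Nat.Tactic.RingSolver using (solve-∀)
open import Data.Product.Base using (_×_; _,_; proj₁; proj₂; ∃)
open import Data.Vec.Base as Vec using ()
open import Data.Vec.Properties using (lookup∘tabulate; []=⇒lookup; lookup⇒[]=)
open import Function.Base using (_∘_; id)
open import Function.Bundles using (_⇔_; mk⇔; Injection; Equivalence)
open import Function.Properties.Inverse using (↔⇒↣)
open import Function.Construct.Identity using (↔-id)
open import Relation.Binary.Construct.Closure.ReflexiveTransitive using (ε; _◅_)
open import Relation.Binary.Definitions using (tri<; tri≈; tri>)
open import Relation.Binary.PropositionalEquality as ≡ using (_≡_; _≢_; cong; cong₂; subst)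
open import Relation.Nullary using (¬_; Dec; yes; no; does; contradiction; _×-dec_)
open import Relation.Nullary.Decidable using (decidable-stable; dec-true)

-- Sums over all subsets of a finite set, with values in a semiring.

module SubsetSum {c ℓ} (R : Semiring c ℓ) where
  open Semiring R hiding (zero)
  open import Algebra.Properties.Semiring.Exp R using (_^_)
  open import Relation.Binary.Reasoning.Setoid setoid

  ∑ₛ : ∀ {n} → (Subset n → Carrier) → Carrier
  ∑ₛ {n} t = foldr _+_ 0# (List.map t (subsets n))

  foldr-+-++ : ∀ xs ys → foldr _+_ 0# (xs ++ ys) ≈ foldr _+_ 0# xs + foldr _+_ 0# ys
  foldr-+-++ []       ys = sym (+-identityˡ _)
  foldr-+-++ (x ∷ xs) ys = trans (+-congˡ (foldr-+-++ xs ys)) (sym (+-assoc x _ _))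

  ∑ₛ-suc : ∀ {n} (t : Subset (suc n) → Carrier) →
           ∑ₛ t ≈ ∑ₛ (t ∘ (outside Vec.∷_)) + ∑ₛ (t ∘ (inside Vec.∷_))
  ∑ₛ-suc {n} t = begin
    ∑ₛ t
      ≡⟨ cong (foldr _+_ 0#) (map-++ t (List.map (outside Vec.∷_) (subsets n)) _) ⟩
    foldr _+_ 0# (List.map t (List.map (outside Vec.∷_) (subsets n)) ++ _)
      ≈⟨ foldr-+-++ (List.map t (List.map (outside Vec.∷_) (subsets n))) _ ⟩
    foldr _+_ 0# (List.map t (List.map (outside Vec.∷_) (subsets n))) + _
      ≡⟨ cong₂ (λ xs ys → foldr _+_ 0# xs + foldr _+_ 0# ys)
           (map-∘ (subsets n)) (map-∘ (subsets n)) ⟨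
    ∑ₛ (t ∘ (outside Vec.∷_)) + ∑ₛ (t ∘ (inside Vec.∷_)) ∎

  ∑ₛ-cong : ∀ {n} {s t : Subset n → Carrier} → (∀ S → s S ≈ t S) → ∑ₛ s ≈ ∑ₛ t
  ∑ₛ-cong {n} s≈t = go (subsets n)
    where
    go : ∀ Ss → foldr _+_ 0# (List.map _ Ss) ≈ foldr _+_ 0# (List.map _ Ss)
    go []       = refl
    go (S ∷ Ss) = +-cong (s≈t S) (go Ss)

  *-distribˡ-∑ₛ : ∀ {n} z (t : Subset n → Carrier) → z * ∑ₛ t ≈ ∑ₛ (λ S → z * t S)
  *-distribˡ-∑ₛ {n} z t = go (subsets n)
    where
    go : ∀ Ss → z * foldr _+_ 0# (List.map t Ss) ≈ foldr _+_ 0# (List.map (λ S → z * t S) Ss)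
    go []       = zeroʳ z
    go (S ∷ Ss) = trans (distribˡ z _ _) (+-congˡ (go Ss))

  -- The binomial theorem without binomial coefficients: each element contributes the factor `1#`
  -- when it is left out and `z` when it is taken.
  ∑ₛ-^ : ∀ n z → ∑ₛ {n} (λ S → z ^ ∣ S ∣) ≈ (1# + z) ^ n
  ∑ₛ-^ zero    z = +-identityʳ 1#
  ∑ₛ-^ (suc n) z = begin
    ∑ₛ {suc n} (λ S → z ^ ∣ S ∣)
      ≈⟨ ∑ₛ-suc {n} (λ S → z ^ ∣ S ∣) ⟩
    ∑ₛ {n} (λ S → z ^ ∣ S ∣) + ∑ₛ {n} (λ S → z * z ^ ∣ S ∣)
      ≈⟨ +-cong (sym (*-identityˡ _)) (sym (*-distribˡ-∑ₛ {n} z (λ S → z ^ ∣ S ∣))) ⟩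
    1# * ∑ₛ {n} (λ S → z ^ ∣ S ∣) + z * ∑ₛ {n} (λ S → z ^ ∣ S ∣)
      ≈⟨ distribʳ _ 1# z ⟨
    (1# + z) * ∑ₛ {n} (λ S → z ^ ∣ S ∣)
      ≈⟨ *-congˡ (∑ₛ-^ n z) ⟩
    (1# + z) * (1# + z) ^ n ∎

  -- The added `1#` stands in for the missing power `z ^ 0` at the empty set. Subsets containing the
  -- first element are all non-empty, so `∑ₛ-^` handles them, and induction handles the others.
  ∑ₛ-nonempty-^ : ∀ {n} z (t : Subset n → Carrier) → t ⊥ ≈ 0# →
                  (∀ {S} → Nonempty S → t S ≈ z ^ ∣ S ∣) → ∑ₛ t + 1# ≈ (1# + z) ^ n
  ∑ₛ-nonempty-^ {zero}  z t t⊥ t^ = begin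
    t Vec.[] + 0# + 1#  ≈⟨ +-congʳ (trans (+-identityʳ _) t⊥) ⟩
    0# + 1#             ≈⟨ +-identityˡ 1# ⟩
    1#                  ∎
  ∑ₛ-nonempty-^ {suc n} z t t⊥ t^ = begin
    ∑ₛ t + 1#
      ≈⟨ +-congʳ (∑ₛ-suc t) ⟩
    ∑ₛ (t ∘ (outside Vec.∷_)) + ∑ₛ (t ∘ (inside Vec.∷_)) + 1#
      -- The `1#` moves to the `outside` half, the only half that contains the empty set.
      ≈⟨ trans (+-assoc _ _ _) (trans (+-congˡ (+-comm _ 1#)) (sym (+-assoc _ _ _))) ⟩
    ∑ₛ (t ∘ (outside Vec.∷_)) + 1# + ∑ₛ (t ∘ (inside Vec.∷_))
      ≈⟨ +-cong
           (∑ₛ-nonempty-^ z (t ∘ (outside Vec.∷_)) t⊥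
             λ (u , u∈S) → t^ (suc u , Vec.there u∈S))
           (∑ₛ-cong λ S → t^ {inside Vec.∷ S} (zero , Vec.here)) ⟩
    (1# + z) ^ n + ∑ₛ {n} (λ S → z * z ^ ∣ S ∣)
      ≈⟨ +-congˡ (*-distribˡ-∑ₛ {n} z (λ S → z ^ ∣ S ∣)) ⟨
    (1# + z) ^ n + z * ∑ₛ {n} (λ S → z ^ ∣ S ∣)
      ≈⟨ +-cong (sym (*-identityˡ _)) (*-congˡ (∑ₛ-^ n z)) ⟩
    1# * (1# + z) ^ n + z * (1# + z) ^ n
      ≈⟨ distribʳ _ 1# z ⟨
    (1# + z) * (1# + z) ^ n ∎

-- Low-order terms of sums and powers in ℕ.

open SubsetSum ℕ.+-*-semiring using () renaming (∑ₛ to ∑ₛℕ; ∑ₛ-suc to ∑ₛℕ-suc)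

∑ : ∀ {n} → (Fin n → ℕ) → ℕ
∑ = sum ℕ.+-*-semiring

module _ where
  open import Data.Nat.Base using (_+_; _*_; _^_)

  -- A congruence modulo `m` with an explicit quotient. In `∑ₛ-linear` it is applied to the subsets
  -- containing a fixed element, where the remaining term `g ⊥` belongs to a singleton.
  ∑ₛ-constant : ∀ {n} m (g : Subset n → ℕ) → (∀ S → 1 ≤ ∣ S ∣ → m ∣ g S) →
                ∃ λ q → ∑ₛℕ g ≡ g ⊥ + q * m
  ∑ₛ-constant {zero}  m g m∣g = 0 , ≡.refl
  ∑ₛ-constant {suc n} m g m∣g
    with q , out ← ∑ₛ-constant m (g ∘ (outside Vec.∷_)) (m∣g ∘ (outside Vec.∷_))
       | r , inn ← ∑ₛ-constant m (g ∘ (inside Vec.∷_)) (λ S _ → m∣g (inside Vec.∷ S) (s≤s z≤n))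
       -- The `inside` half leaves over its own empty set, which is `⁅ zero ⁆` in the whole and is
       -- again divisible by `m`.
       | divides s g≡ ← m∣g ⁅ zero ⁆ (s≤s z≤n)
    = q + (s + r) , (begin
    ∑ₛℕ g                             ≡⟨ ∑ₛℕ-suc g ⟩
    _                                 ≡⟨ cong₂ _+_ out inn ⟩
    g ⊥ + q * m + (g ⁅ zero ⁆ + r * m) ≡⟨ cong (λ k → g ⊥ + q * m + (k + r * m)) g≡ ⟩
    g ⊥ + q * m + (s * m + r * m)     ≡⟨ rearrange (g ⊥) q s r m ⟩
    g ⊥ + (q + (s + r)) * m           ∎)
    where
    open ≡.≡-Reasoning
    rearrange : ∀ a q s r m → a + q * m + (s * m + r * m) ≡ a + (q + (s + r)) * m
    rearrange = solve-∀

  -- With `m` equal to `x ^ 2`, this isolates the part of degree at most one in `x`.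
  ∑ₛ-linear : ∀ {n} m (g : Subset n → ℕ) → (∀ S → 2 ≤ ∣ S ∣ → m ∣ g S) →
              ∃ λ q → ∑ₛℕ g ≡ g ⊥ + ∑ (λ u → g ⁅ u ⁆) + q * m
  ∑ₛ-linear {zero}  m g m∣g = 0 , ≡.sym (ℕ.+-identityʳ _)
  ∑ₛ-linear {suc n} m g m∣g
    with q , out ← ∑ₛ-linear m (g ∘ (outside Vec.∷_)) (m∣g ∘ (outside Vec.∷_))
       -- Dropping the element `zero` lowers the size by one, so the bound 2 becomes the bound 1 of
       -- `∑ₛ-constant`.
       | r , inn ← ∑ₛ-constant m (g ∘ (inside Vec.∷_)) (λ S → m∣g (inside Vec.∷ S) ∘ s≤s)
    = q + r , (begin
    ∑ₛℕ g                             ≡⟨ ∑ₛℕ-suc g ⟩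
    _                                 ≡⟨ cong₂ _+_ out inn ⟩
    g ⊥ + tl + q * m + (g ⁅ zero ⁆ + r * m) ≡⟨ rearrange (g ⊥) tl (g ⁅ zero ⁆) q r m ⟩
    g ⊥ + (g ⁅ zero ⁆ + tl) + (q + r) * m ∎)
    where
    open ≡.≡-Reasoning
    tl : ℕ
    tl = ∑ (λ u → g ⁅ suc u ⁆)
    rearrange : ∀ a t z q r m → a + t + q * m + (z + r * m) ≡ a + (z + t) + (q + r) * m
    rearrange = solve-∀

  ∑-≡ : ∀ {n} {g : Fin n → ℕ} {c} → (∀ i → g i ≡ c) → ∑ g ≡ n * c
  ∑-≡ {zero}  g≡c = ≡.refl
  ∑-≡ {suc n} g≡c = cong₂ _+_ (g≡c zero) (∑-≡ (g≡c ∘ suc))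

  ∑-≥ : ∀ {n} {g : Fin n → ℕ} {c} → (∀ i → c ≤ g i) → n * c ≤ ∑ g
  ∑-≥ {zero}  c≤g = z≤n
  ∑-≥ {suc n} c≤g = ℕ.+-mono-≤ (c≤g zero) (∑-≥ (c≤g ∘ suc))

  -- There is no slack: a single term above `c` would push the sum above `n * c`, since the others
  -- are at least `c`.
  ∑-minimal : ∀ {n} {g : Fin n → ℕ} {c} → (∀ i → c ≤ g i) → ∑ g ≤ n * c → ∀ i → g i ≤ c
  ∑-minimal {suc n} {g} {c} c≤g ∑g≤ zero =
    ℕ.+-cancelʳ-≤ (n * c) _ c (ℕ.≤-trans (ℕ.+-monoʳ-≤ (g zero) (∑-≥ (c≤g ∘ suc))) ∑g≤)
  ∑-minimal {suc n} {g} {c} c≤g ∑g≤ (suc i) =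
    ∑-minimal (c≤g ∘ suc)
      (ℕ.+-cancelˡ-≤ c _ (n * c) (ℕ.≤-trans (ℕ.+-monoˡ-≤ _ (c≤g zero)) ∑g≤)) i

  binomial-linear : ∀ n z → ∃ λ q → (1 + z) ^ n ≡ 1 + n * z + q * (z * z)
  binomial-linear zero    z = 0 , ≡.refl
  binomial-linear (suc n) z with q , eq ← binomial-linear n z =
    -- Multiplying by `1 + z` adds `n` from the linear term and `z * q` from the old quotient.
    n + q + z * q , ≡.trans (cong ((1 + z) *_) eq) (rearrange n z q)
    where
    rearrange : ∀ n z q → (1 + z) * (1 + n * z + q * (z * z)) ≡
                          1 + suc n * z + (n + q + z * q) * (z * z)
    rearrange = solve-∀

  -- Both sides have a unique remainder modulo `m`. With a large `m` this replaces the comparison of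
  -- polynomial coefficients.
  ≡-mod-large : ∀ {a b q r} m .{{_ : NonZero m}} → a < m → b < m → a + q * m ≡ b + r * m → a ≡ b
  ≡-mod-large {a} {b} {q} {r} m a<m b<m eq = begin
    a                ≡⟨ m<n⇒m%n≡m a<m ⟨
    a % m            ≡⟨ [m+kn]%n≡m%n a q m ⟨
    (a + q * m) % m  ≡⟨ cong (_% m) eq ⟩
    (b + r * m) % m  ≡⟨ [m+kn]%n≡m%n b r m ⟩
    b % m            ≡⟨ m<n⇒m%n≡m b<m ⟩
    b                ∎
    where open ≡.≡-Reasoning

  ^-monoʳ-∣ : ∀ m {k l} → k ≤ l → m ^ k ∣ m ^ l
  ^-monoʳ-∣ m {k} k≤l with o , ≡.refl ← ℕ.m≤n⇒∃[o]m+o≡n k≤l =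
    subst (m ^ k ∣_) (≡.sym (ℕ.^-distribˡ-+-* m k o)) (m∣m*n (m ^ o))

-- Subset sizes, neighbourhoods and scores.

∣p∩q∣+∣p∩∁q∣≡∣p∣ : ∀ {n} (p q : Subset n) → ∣ p ∩ q ∣ ℕ.+ ∣ p ∩ ∁ q ∣ ≡ ∣ p ∣
∣p∩q∣+∣p∩∁q∣≡∣p∣ Vec.[]             Vec.[]             = ≡.refl
∣p∩q∣+∣p∩∁q∣≡∣p∣ (outside Vec.∷ p) (_ Vec.∷ q)       = ∣p∩q∣+∣p∩∁q∣≡∣p∣ p q
∣p∩q∣+∣p∩∁q∣≡∣p∣ (inside Vec.∷ p)  (inside Vec.∷ q)  = cong suc (∣p∩q∣+∣p∩∁q∣≡∣p∣ p q)
∣p∩q∣+∣p∩∁q∣≡∣p∣ (inside Vec.∷ p)  (outside Vec.∷ q) =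
  ≡.trans (ℕ.+-suc _ _) (cong suc (∣p∩q∣+∣p∩∁q∣≡∣p∣ p q))

module GraphProperties (G : Graph) where
  open Graph G
  open import Data.Nat.Base using (_+_; _*_; _^_)

  Complete : Set
  Complete = ∀ {u v} → u ≢ v → u ~ v

  ∈neighbourhood⁺ : ∀ {u v} → u ~ v → v ∈ neighbourhood G u
  ∈neighbourhood⁺ {u} {v} u~v =
    lookup⇒[]= v _ (≡.trans (lookup∘tabulate _ v) (dec-true (u ~? v) u~v))

  ∈neighbourhood⁻ : ∀ {u v} → v ∈ neighbourhood G u → u ~ v
  ∈neighbourhood⁻ {u} {v} v∈N
    with u ~? v | ≡.trans (≡.sym (lookup∘tabulate (does ∘ (u ~?_)) v)) ([]=⇒lookup v∈N)
  ... | yes u~v | _  = u~v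
  ... | no  _   | ()

  -- The seed of the minimum comes from a member of `S`, so it equals `c` just as the listed values
  -- do.
  f-y-constant : ∀ {S c} → (∀ {u} → u ∈ S → score G S u ≡ c) → ∀ S≢∅ → f-y G S S≢∅ ≡ c
  f-y-constant {S} {c} score≡c (_ , u₀∈S) =
    argmin-all id {P = _≡ c} (score≡c u₀∈S)
      (map⁺ (All.map score≡c (all-filter (_∈? S) (List.allFin order))))

  -- This is |V| - deg u, because `u` is not its own neighbour.
  singletonScore : Vertex → ℕ
  singletonScore u = score G ⁅ u ⁆ u

  f-y-singleton : ∀ u ⁅u⁆≢∅ → f-y G ⁅ u ⁆ ⁅u⁆≢∅ ≡ singletonScore u
  f-y-singleton u = f-y-constant λ v∈ → cong (score G ⁅ u ⁆) (x∈⁅y⁆⇒x≡y u v∈)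

  singleton-connected : ∀ u → InducedConnected G ⁅ u ⁆
  singleton-connected u v w v∈ w∈
    with ≡.refl ← x∈⁅y⁆⇒x≡y u v∈ | ≡.refl ← x∈⁅y⁆⇒x≡y u w∈ = ε

  suc∣∁⁅u⁆∣≡order : ∀ u → suc ∣ ∁ ⁅ u ⁆ ∣ ≡ order
  suc∣∁⁅u⁆∣≡order u = ≡.trans
    (cong suc (≡.trans (∣∁p∣≡n∸∣p∣ ⁅ u ⁆) (cong (order ∸_) (∣⁅x⁆∣≡1 u))))
    -- A graph has at least one vertex, so subtracting 1 from `order` does not truncate.
    (ℕ.m+[n∸m]≡n {1} {order} (ℕ.>-nonZero⁻¹ order))

  -- Outside `⁅ u ⁆` there are only |V| - 1 vertices that can be subtracted.
  singletonScore≥1 : ∀ u → 1 ≤ singletonScore u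
  singletonScore≥1 u = ℕ.m<n⇒0<n∸m (begin-strict
    δ G (∁ ⁅ u ⁆) u      ≤⟨ ∣p∩q∣≤∣p∣ (∁ ⁅ u ⁆) (neighbourhood G u) ⟩
    ∣ ∁ ⁅ u ⁆ ∣          <⟨ ℕ.≤-reflexive (suc∣∁⁅u⁆∣≡order u) ⟩
    order                ≤⟨ ℕ.m≤n+m order _ ⟩
    δ G ⁅ u ⁆ u + order  ∎)
    where open ℕ.≤-Reasoning

  -- A score of at most 1 forces at least |V| - 1 neighbours outside `⁅ u ⁆`, while a non-neighbour
  -- `v` would leave fewer.
  singletonScore≤1⇒adjacent : ∀ {u v} → singletonScore u ≤ 1 → u ≢ v → u ~ v
  singletonScore≤1⇒adjacent {u} {v} score≤1 u≢v = decidable-stable (u ~? v) λ u≁v →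
    ℕ.<-irrefl ≡.refl (begin-strict
      suc ∣ ∁ ⁅ u ⁆ ∣          ≡⟨ suc∣∁⁅u⁆∣≡order u ⟩
      order                    ≤⟨ ℕ.m≤n+m∸n order (δ G (∁ ⁅ u ⁆) u) ⟩
      δ G (∁ ⁅ u ⁆) u + (order ∸ δ G (∁ ⁅ u ⁆) u)
        ≤⟨ ℕ.+-monoʳ-≤ (δ G (∁ ⁅ u ⁆) u)
             (ℕ.≤-trans (ℕ.∸-monoˡ-≤ (δ G (∁ ⁅ u ⁆) u) (ℕ.m≤n+m order (δ G ⁅ u ⁆ u)))
                                 score≤1) ⟩
      δ G (∁ ⁅ u ⁆) u + 1      ≡⟨ ℕ.+-comm _ 1 ⟩
      suc (δ G (∁ ⁅ u ⁆) u)
        <⟨ s≤s (p⊂q⇒∣p∣<∣q∣ (p∩q⊆p (∁ ⁅ u ⁆) (neighbourhood G u) , v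
             , x∉p⇒x∈∁p (u≢v ∘ ≡.sym ∘ x∈⁅y⁆⇒x≡y u)
             , u≁v ∘ ∈neighbourhood⁻ ∘ p∩q⊆q (∁ ⁅ u ⁆) (neighbourhood G u))) ⟩
      suc ∣ ∁ ⁅ u ⁆ ∣          ∎)
    where open ℕ.≤-Reasoning

  -- Complete graphs and their scores.

  module _ (complete : Complete) where

    complete⇒connected : ∀ S → InducedConnected G S
    complete⇒connected S u v u∈S v∈S with u ≟ v
    ... | yes ≡.refl = ε
    ... | no  u≢v    = (u∈S , v∈S , complete u≢v) ◅ ε

    complete⇒neighbourhood : ∀ u → neighbourhood G u ≡ ∁ ⁅ u ⁆
    complete⇒neighbourhood u = ⊆-antisym
      (λ v∈N → x∉p⇒x∈∁p λ v∈⁅u⁆ →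
        ~-irrefl (≡.sym (x∈⁅y⁆⇒x≡y u v∈⁅u⁆)) (∈neighbourhood⁻ v∈N))
      (λ v∈∁ → ∈neighbourhood⁺ (complete λ { ≡.refl → x∈∁p⇒x∉p v∈∁ (x∈⁅x⁆ u) }))

    -- Here `u` has |S| - 1 neighbours in `S` and |V| - |S| outside. The `suc` avoids a subtraction
    -- and matches the extra factor y in y · da.
    complete⇒suc-score : ∀ {S u} → u ∈ S → suc (score G S u) ≡ 2 * ∣ S ∣
    complete⇒suc-score {S} {u} u∈S = begin
      suc (δ G S u + order ∸ δ G (∁ S) u)
        ≡⟨ cong (λ k → suc (δ G S u + order ∸ k)) δ∁S ⟩
      suc (δ G S u + order ∸ (order ∸ ∣ S ∣))
        ≡⟨ cong suc (ℕ.+-∸-assoc (δ G S u) (ℕ.m∸n≤m order ∣ S ∣)) ⟩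
      suc (δ G S u) + (order ∸ (order ∸ ∣ S ∣))
        ≡⟨ cong₂ _+_ sucδS (ℕ.m∸[m∸n]≡n (∣p∣≤n S)) ⟩
      ∣ S ∣ + ∣ S ∣
        ≡⟨ cong (∣ S ∣ +_) (ℕ.+-identityʳ _) ⟨
      2 * ∣ S ∣ ∎
      where
      open ≡.≡-Reasoning
      ⁅u⁆⊆S : ∀ {v} → v ∈ ⁅ u ⁆ → v ∈ S
      ⁅u⁆⊆S v∈ = subst (_∈ S) (≡.sym (x∈⁅y⁆⇒x≡y u v∈)) u∈S
      S∩⁅u⁆ : S ∩ ⁅ u ⁆ ≡ ⁅ u ⁆
      S∩⁅u⁆ = ⊆-antisym (p∩q⊆q S ⁅ u ⁆) (λ v∈ → x∈p∩q⁺ (⁅u⁆⊆S v∈ , v∈))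
      ∁S∩∁⁅u⁆ : ∁ S ∩ ∁ ⁅ u ⁆ ≡ ∁ S
      ∁S∩∁⁅u⁆ = ⊆-antisym (p∩q⊆p (∁ S) (∁ ⁅ u ⁆))
        (λ v∈ → x∈p∩q⁺ (v∈ , x∉p⇒x∈∁p (x∈∁p⇒x∉p v∈ ∘ ⁅u⁆⊆S)))
      sucδS : suc (δ G S u) ≡ ∣ S ∣
      sucδS = begin
        suc ∣ S ∩ neighbourhood G u ∣  ≡⟨ cong (λ N → suc ∣ S ∩ N ∣) (complete⇒neighbourhood u) ⟩
        1 + ∣ S ∩ ∁ ⁅ u ⁆ ∣            ≡⟨ cong (_+ ∣ S ∩ ∁ ⁅ u ⁆ ∣) (≡.trans (cong ∣_∣ S∩⁅u⁆) (∣⁅x⁆∣≡1 u)) ⟨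
        ∣ S ∩ ⁅ u ⁆ ∣ + ∣ S ∩ ∁ ⁅ u ⁆ ∣ ≡⟨ ∣p∩q∣+∣p∩∁q∣≡∣p∣ S ⁅ u ⁆ ⟩
        ∣ S ∣                          ∎
      δ∁S : δ G (∁ S) u ≡ order ∸ ∣ S ∣
      δ∁S = begin
        ∣ ∁ S ∩ neighbourhood G u ∣  ≡⟨ cong (λ N → ∣ ∁ S ∩ N ∣) (complete⇒neighbourhood u) ⟩
        ∣ ∁ S ∩ ∁ ⁅ u ⁆ ∣            ≡⟨ cong ∣_∣ ∁S∩∁⁅u⁆ ⟩
        ∣ ∁ S ∣                      ≡⟨ ∣∁p∣≡n∸∣p∣ S ⟩
        order ∸ ∣ S ∣                ∎

    complete⇒suc-f-y : ∀ {S} S≢∅ → suc (f-y G S S≢∅) ≡ 2 * ∣ S ∣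
    complete⇒suc-f-y {S} S≢∅@(_ , u₀∈S) = ≡.trans
      (cong suc (f-y-constant
        (λ u∈S → ℕ.suc-injective
          (≡.trans (complete⇒suc-score u∈S) (≡.sym (complete⇒suc-score u₀∈S)))) S≢∅))
      (complete⇒suc-score u₀∈S)

  complete⇒≅K : ∀ {n} .{{_ : NonZero n}} → order ≡ n → Complete → G ≅ K n
  complete⇒≅K ≡.refl complete = record
    { bijection = ↔-id _
    ; adjacency = λ u v → mk⇔ (λ u~v u≡v → ~-irrefl u≡v u~v) complete
    }

  ≅K⇒complete : ∀ {n} .{{_ : NonZero n}} → G ≅ K n → Complete
  ≅K⇒complete G≅K {u} {v} u≢v =
    Equivalence.from (adjacency u v) (u≢v ∘ Injection.injective (↔⇒↣ bijection))
    where open _≅_ G≅K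

  ≅K⇒order≡ : ∀ {n} .{{_ : NonZero n}} → G ≅ K n → order ≡ n
  ≅K⇒order≡ G≅K = ↔⇒≡ (_≅_.bijection G≅K)

  -- The polynomial evaluated at natural numbers.

  termℕ : ℕ → ℕ → ∀ S → Dec (Nonempty S × InducedConnected G S) → ℕ
  termℕ x y S (yes (S≢∅ , _)) = x ^ ∣ S ∣ * y ^ f-y G S S≢∅
  termℕ x y S (no _)          = 0

  connected? : ∀ S → Dec (Nonempty S × InducedConnected G S)
  connected? S = nonempty? S ×-dec inducedConnected? G S

  daℕ : ℕ → ℕ → ℕ
  daℕ x y = ∑ₛℕ λ S → termℕ x y S (connected? S)

  -- This and the next two lemmas take an arbitrary decision `d`, so that a case split suffices
  -- without evaluating `connected?`.
  termℕ-⊥ : ∀ x y d → termℕ x y ⊥ d ≡ 0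
  termℕ-⊥ x y (yes ((_ , u∈⊥) , _)) = contradiction u∈⊥ ∉⊥
  termℕ-⊥ x y (no _)                = ≡.refl

  termℕ-singleton : ∀ x y u d → termℕ x y ⁅ u ⁆ d ≡ x * y ^ singletonScore u
  termℕ-singleton x y u (yes (⁅u⁆≢∅ , _)) = cong₂ (λ k l → k * y ^ l)
    (≡.trans (cong (x ^_) (∣⁅x⁆∣≡1 u)) (ℕ.^-identityʳ x)) (f-y-singleton u ⁅u⁆≢∅)
  termℕ-singleton x y u (no ¬c) =
    contradiction ((u , x∈⁅x⁆ u) , singleton-connected u) ¬c

  x²∣termℕ : ∀ x y {S} d → 2 ≤ ∣ S ∣ → x ^ 2 ∣ termℕ x y S d
  x²∣termℕ x y {S} (yes _) 2≤∣S∣ = ∣-trans (^-monoʳ-∣ x 2≤∣S∣) (m∣m*n _)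
  x²∣termℕ x y     (no _)  _     = _ ∣0

  -- Every singleton is connected and gives the degree-one part; larger sets contribute multiples of
  -- `x ^ 2`, connected or not.
  daℕ-linear : ∀ x y → ∃ λ q → daℕ x y ≡ x * ∑ (λ u → y ^ singletonScore u) + q * x ^ 2
  daℕ-linear x y
    with q , eq ← ∑ₛ-linear (x ^ 2) (λ S → termℕ x y S (connected? S))
                    (λ S → x²∣termℕ x y (connected? S))
    = q , ≡.trans eq (cong (_+ q * x ^ 2) (begin
    termℕ x y ⊥ (connected? ⊥) + ∑ (λ u → termℕ x y ⁅ u ⁆ (connected? ⁅ u ⁆))
      ≡⟨ cong₂ _+_ (termℕ-⊥ x y (connected? ⊥))
           (sum-cong-≗ ℕ.+-*-semiring λ u → termℕ-singleton x y u (connected? ⁅ u ⁆)) ⟩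
    ∑ (λ u → x * y ^ singletonScore u)
      ≡⟨ *-distribˡ-sum ℕ.+-*-semiring x (λ u → y ^ singletonScore u) ⟨
    x * ∑ (λ u → y ^ singletonScore u) ∎))
    where open ≡.≡-Reasoning

  -- Recovering order and completeness from the identity over ℕ.

  module _ {n} (identity : ∀ x y .{{_ : NonZero y}} → y * daℕ x y + 1 ≡ (1 + x * y ^ 2) ^ n) where

    ∑-singletonScore : ∀ y .{{_ : NonZero y}} → ∑ (λ u → y ^ singletonScore u) ≡ n * y
    -- x is taken larger than both sides, so that comparing modulo x suffices.
    ∑-singletonScore y = ≡-mod-large {q = q} {r = r * (y * y * y)} x
      (s≤s (ℕ.m≤m+n P _)) (s≤s (ℕ.m≤n+m _ P))
      -- Both sides of the identity are 1 plus a multiple of `x * y`; removing the 1 and cancelling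
      -- leaves `P` and `n * y`, each up to a multiple of `x`.
      (ℕ.*-cancelˡ-≡ _ _ (x * y) {{ℕ.m*n≢0 x y}} (ℕ.suc-injective (begin
        suc (x * y * (P + q * x))             ≡⟨ expand x y P q ⟨
        y * (x * P + q * x ^ 2) + 1           ≡⟨ cong (λ d → y * d + 1) da≡ ⟨
        y * daℕ x y + 1                       ≡⟨ identity x y ⟩
        (1 + x * y ^ 2) ^ n                   ≡⟨ pow≡ ⟩
        1 + n * (x * y ^ 2) + r * (x * y ^ 2 * (x * y ^ 2))
                                              ≡⟨ collect n r x y ⟩
        suc (x * y * (n * y + r * (y * y * y) * x))
                                              ∎)))
      where
      open ≡.≡-Reasoning
      P x q r : ℕ
      P = ∑ (λ u → y ^ singletonScore u)
      x = suc (P + n * y)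
      q = proj₁ (daℕ-linear x y)
      r = proj₁ (binomial-linear n (x * y ^ 2))
      da≡ : daℕ x y ≡ x * P + q * x ^ 2
      da≡ = proj₂ (daℕ-linear x y)
      pow≡ : (1 + x * y ^ 2) ^ n ≡ 1 + n * (x * y ^ 2) + r * (x * y ^ 2 * (x * y ^ 2))
      pow≡ = proj₂ (binomial-linear n (x * y ^ 2))
      -- y * (y * 1) is y ^ 2 unfolded: solve-∀ does not interpret _^_ on ℕ.
      expand : ∀ x y P q → y * (x * P + q * (x * (x * 1))) + 1 ≡ suc (x * y * (P + q * x))
      expand = solve-∀
      collect : ∀ n r x y →
        1 + n * (x * (y * (y * 1))) + r * (x * (y * (y * 1)) * (x * (y * (y * 1)))) ≡
        suc (x * y * (n * y + r * (y * y * y) * x))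
      collect = solve-∀

    identity⇒order≡ : order ≡ n
    identity⇒order≡ = begin
      order                             ≡⟨ ℕ.*-identityʳ order ⟨
      order * 1                         ≡⟨ ∑-≡ (λ u → ℕ.^-zeroˡ (singletonScore u)) ⟨
      ∑ (λ u → 1 ^ singletonScore u)    ≡⟨ ∑-singletonScore 1 ⟩
      n * 1                             ≡⟨ ℕ.*-identityʳ n ⟩
      n                                 ∎
      where open ≡.≡-Reasoning

    identity⇒complete : Complete
    identity⇒complete {u} = singletonScore≤1⇒adjacent (ℕ.≮⇒≥ λ 1<s →
      -- A score above 1 gives a power above 2, but `order` many powers, each at least 2, sum to
      -- exactly `order * 2`.
      ℕ.<⇒≱ (ℕ.^-monoʳ-< 2 (s≤s (s≤s z≤n)) 1<s)
        (∑-minimal (λ v → ℕ.^-monoʳ-≤ 2 (singletonScore≥1 v))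
          (ℕ.≤-reflexive (≡.trans (∑-singletonScore 2) (cong (_* 2) (≡.sym identity⇒order≡)))) u))

-- Clearing the denominator in a Heyting field.

module HeytingFieldProperties {c ℓ₁ ℓ₂} (F : HeytingField c ℓ₁ ℓ₂) where
  open HeytingField F hiding (zero)
  open FieldNotions F
  private
    R : CommutativeRing c ℓ₁
    R = HeytingCommutativeRing.commutativeRing heytingCommutativeRing
  open CommutativeRing R using (semiring; commutativeSemiring; +-abelianGroup)
  open AbelianGroupProperties +-abelianGroup using (∙-cancelˡ)
  open Exp commutativeSemiring using (^-congˡ; ^-congʳ; ^-assocʳ; ^-distrib-*; y*x^m*y^n≈x^m*y^[n+1])
  open Mult semiring using (×-homo-+; ×-homo-1; ×1-homo-*)
  open SubsetSum semiring
  open import Relation.Binary.Reasoning.Setoid setoid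

  x-y+y≈x : ∀ x y → x - y + y ≈ x
  x-y+y≈x x y = trans (+-assoc x _ y) (trans (+-congˡ (-‿inverseˡ y)) (+-identityʳ x))

  x+y-y≈x : ∀ x y → x + y - y ≈ x
  x+y-y≈x x y = trans (+-assoc x y _) (trans (+-congˡ (-‿inverseʳ y)) (+-identityʳ x))

  module _ {y} (y#0 : y # 0#) where
    private
      y⁻¹ : Carrier
      y⁻¹ = proj₁ (#⇒invertible y#0)

      y*y⁻¹≈1 : y * y⁻¹ ≈ 1#
      y*y⁻¹≈1 = begin
        y * y⁻¹         ≈⟨ *-congʳ (trans (sym (x-y+y≈x y 0#)) (+-identityʳ _)) ⟩
        (y - 0#) * y⁻¹  ≈⟨ proj₂ (proj₂ (#⇒invertible y#0)) ⟩
        1#              ∎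

    ≈/⇒*+1≈ : ∀ {d p} → d ≈ (p - 1#) / y [ y#0 ] → y * d + 1# ≈ p
    ≈/⇒*+1≈ {d} {p} d≈ = begin
      y * d + 1#                   ≈⟨ +-congʳ (*-congˡ d≈) ⟩
      y * ((p - 1#) * y⁻¹) + 1#    ≈⟨ +-congʳ (*-congˡ (*-comm _ _)) ⟩
      y * (y⁻¹ * (p - 1#)) + 1#    ≈⟨ +-congʳ (*-assoc _ _ _) ⟨
      y * y⁻¹ * (p - 1#) + 1#      ≈⟨ +-congʳ (*-congʳ y*y⁻¹≈1) ⟩
      1# * (p - 1#) + 1#           ≈⟨ +-congʳ (*-identityˡ _) ⟩
      p - 1# + 1#                  ≈⟨ x-y+y≈x p 1# ⟩
      p                            ∎

    *+1≈⇒≈/ : ∀ {d p} → y * d + 1# ≈ p → d ≈ (p - 1#) / y [ y#0 ]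
    *+1≈⇒≈/ {d} {p} ≈p = begin
      d                            ≈⟨ *-identityˡ d ⟨
      1# * d                       ≈⟨ *-congʳ y*y⁻¹≈1 ⟨
      y * y⁻¹ * d                  ≈⟨ trans (*-congʳ (*-comm _ _)) (*-assoc _ _ _) ⟩
      y⁻¹ * (y * d)                ≈⟨ *-comm _ _ ⟩
      y * d * y⁻¹                  ≈⟨ *-congʳ (x+y-y≈x (y * d) 1#) ⟨
      (y * d + 1# - 1#) * y⁻¹      ≈⟨ *-congʳ (+-congʳ ≈p) ⟩
      (p - 1#) * y⁻¹               ∎

  -- The identity for complete graphs.

  module _ (G : Graph) where
    open Graph G using (order)
    open GraphProperties G

    complete⇒identity : Complete → ∀ x y → y * da G x y + 1# ≈ (1# + x * y ^ 2) ^ order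
    complete⇒identity complete x y = begin
      y * da G x y + 1#
        ≈⟨ +-congʳ (*-distribˡ-∑ₛ y (λ S → term G x y S (connected? S))) ⟩
      ∑ₛ (λ S → y * term G x y S (connected? S)) + 1#
        ≈⟨ ∑ₛ-nonempty-^ (x * y ^ 2) (λ S → y * term G x y S (connected? S))
           (term-⊥ (connected? ⊥)) (λ {S} → term-^ (connected? S)) ⟩
      (1# + x * y ^ 2) ^ order ∎
      where
      term-⊥ : ∀ d → y * term G x y ⊥ d ≈ 0#
      term-⊥ (yes ((_ , u∈⊥) , _)) = contradiction u∈⊥ ∉⊥
      term-⊥ (no _)                = zeroʳ y

      term-^ : ∀ {S} d → Nonempty S → y * term G x y S d ≈ (x * y ^ 2) ^ ∣ S ∣
      term-^ {S} (yes (S≢∅ , _)) _ = begin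
        -- The factor `y` raises the odd exponent 2|S| - 1 to 2|S|, so the term becomes a power of
        -- `x * y ^ 2`.
        y * (x ^ ∣ S ∣ * y ^ f-y G S S≢∅)   ≈⟨ y*x^m*y^n≈x^m*y^[n+1] (*-comm x y) ∣ S ∣ (f-y G S S≢∅) ⟩
        x ^ ∣ S ∣ * y ^ suc (f-y G S S≢∅)   ≈⟨ *-congˡ (^-congʳ y (complete⇒suc-f-y complete S≢∅)) ⟩
        x ^ ∣ S ∣ * y ^ (2 ℕ.* ∣ S ∣)       ≈⟨ *-congˡ (^-assocʳ y 2 ∣ S ∣) ⟨
        x ^ ∣ S ∣ * (y ^ 2) ^ ∣ S ∣         ≈⟨ ^-distrib-* x (y ^ 2) ∣ S ∣ ⟨
        (x * y ^ 2) ^ ∣ S ∣                 ∎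
      term-^ {S} (no ¬c) S≢∅ = contradiction (S≢∅ , complete⇒connected complete S) ¬c

  -- The natural numbers inside the field.

  ι : ℕ → Carrier
  ι n = n · 1#

  ι-+ : ∀ m n → ι (m ℕ.+ n) ≈ ι m + ι n
  ι-+ = ×-homo-+ 1#

  ι-* : ∀ m n → ι (m ℕ.* n) ≈ ι m * ι n
  ι-* = ×1-homo-*

  ι-^ : ∀ m n → ι (m ℕ.^ n) ≈ ι m ^ n
  ι-^ m zero    = ×-homo-1 1#
  ι-^ m (suc n) = trans (ι-* m (m ℕ.^ n)) (*-congˡ (ι-^ m n))

  -- Both sums run over the same list and decide by the same `connected?`, so the homomorphism laws
  -- apply term by term.
  ι-da : ∀ G a b → ι (GraphProperties.daℕ G a b) ≈ da G (ι a) (ι b)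
  ι-da G a b = ι-foldr (subsets _)
    where
    open GraphProperties G
    ι-term : ∀ {S} d → ι (termℕ a b S d) ≈ term G (ι a) (ι b) S d
    ι-term {S} (yes (S≢∅ , _)) = trans
      (ι-* (a ℕ.^ ∣ S ∣) (b ℕ.^ f-y G S S≢∅)) (*-cong (ι-^ a ∣ S ∣) (ι-^ b (f-y G S S≢∅)))
    ι-term     (no _)          = refl

    ι-foldr : ∀ Ss → ι (foldr ℕ._+_ 0 (List.map (λ S → termℕ a b S (connected? S)) Ss)) ≈
                     foldr _+_ 0# (List.map (λ S → term G (ι a) (ι b) S (connected? S)) Ss)
    ι-foldr []       = refl
    ι-foldr (S ∷ Ss) =
      trans (ι-+ (termℕ a b S (connected? S)) _) (+-cong (ι-term (connected? S)) (ι-foldr Ss))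

  module _ (char0 : CharacteristicZero) where

    -- Cancelling `ι m` would make the image of the positive difference zero, against characteristic
    -- zero.
    ι-< : ∀ {m n} → m < n → ¬ ι m ≈ ι n
    ι-< {m} m<n ιm≈ιn with k , ≡.refl ← ℕ.m≤n⇒∃[o]m+o≡n m<n = #-irrefl ι[suck]≈0 (char0 k)
      where
      ι[suck]≈0 : ι (suc k) ≈ 0#
      ι[suck]≈0 = ∙-cancelˡ (ι m) _ _ (begin
        ι m + ι (suc k)    ≈⟨ ι-+ m (suc k) ⟨
        ι (m ℕ.+ suc k)    ≡⟨ cong ι (ℕ.+-suc m k) ⟩
        ι (suc m ℕ.+ k)    ≈⟨ ιm≈ιn ⟨
        ι m                ≈⟨ +-identityʳ _ ⟨
        ι m + 0#           ∎)

    ι-injective : ∀ {m n} → ι m ≈ ι n → m ≡ n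
    ι-injective {m} {n} ιm≈ιn with ℕ.<-cmp m n
    ... | tri< m<n _ _ = contradiction ιm≈ιn (ι-< m<n)
    ... | tri≈ _ m≡n _ = m≡n
    ... | tri> _ _ n<m = contradiction (sym ιm≈ιn) (ι-< n<m)

    identity⇒identityℕ : ∀ {n} G →
      (∀ x y → y # 0# → y * da G x y + 1# ≈ (1# + x * y ^ 2) ^ n) →
      ∀ a b .{{_ : NonZero b}} →
      b ℕ.* GraphProperties.daℕ G a b ℕ.+ 1 ≡ (1 ℕ.+ a ℕ.* b ℕ.^ 2) ℕ.^ n
    identity⇒identityℕ {n} G identity a b@(suc b-1) = ι-injective (begin
      ι (b ℕ.* daℕ a b ℕ.+ 1)              ≈⟨ ι-+ (b ℕ.* daℕ a b) 1 ⟩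
      ι (b ℕ.* daℕ a b) + ι 1              ≈⟨ +-cong (ι-* b (daℕ a b)) (×-homo-1 1#) ⟩
      ι b * ι (daℕ a b) + 1#               ≈⟨ +-congʳ (*-congˡ (ι-da G a b)) ⟩
      -- As `b` is `suc b-1`, characteristic zero says precisely that `ι b` is apart from `0#`.
      ι b * da G (ι a) (ι b) + 1#          ≈⟨ identity (ι a) (ι b) (char0 b-1) ⟩
      (1# + ι a * ι b ^ 2) ^ n             ≈⟨ ^-congˡ n (+-congˡ (*-congˡ (ι-^ b 2))) ⟨
      -- `ι (1 + k)` unfolds to `1# + ι k`, so only the product needs a homomorphism law.
      (1# + ι a * ι (b ℕ.^ 2)) ^ n         ≈⟨ ^-congˡ n (+-congˡ (ι-* a (b ℕ.^ 2))) ⟨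
      ι (1 ℕ.+ a ℕ.* b ℕ.^ 2) ^ n          ≈⟨ ι-^ (1 ℕ.+ a ℕ.* b ℕ.^ 2) n ⟨
      ι ((1 ℕ.+ a ℕ.* b ℕ.^ 2) ℕ.^ n)      ∎)
      where open GraphProperties G using (daℕ)

-- The equivalence over a Heyting field of characteristic zero.

proposition20 : ∀ {c ℓ₁ ℓ₂} (F : HeytingField c ℓ₁ ℓ₂) →
    let open HeytingField F
        open FieldNotions F in
    CharacteristicZero →
    ∀ (n : ℕ) .{{_ : NonZero n}} (G : Graph) →
    (G ≅ K n) ⇔
      (∀ (x y : Carrier) (y≠0 : y # 0#) →
        da G x y ≈ ((1# + x * y ^ 2) ^ n - 1#) / y [ y≠0 ])
proposition20 F char0 n G = mk⇔ to from
  where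
  open HeytingField F
  open FieldNotions F
  open HeytingFieldProperties F
  open GraphProperties G

  to : G ≅ K n → ∀ x y (y≠0 : y # 0#) → da G x y ≈ ((1# + x * y ^ 2) ^ n - 1#) / y [ y≠0 ]
  to G≅K x y y≠0 = *+1≈⇒≈/ y≠0
    (subst (λ k → y * da G x y + 1# ≈ (1# + x * y ^ 2) ^ k) (≅K⇒order≡ G≅K)
      (complete⇒identity G (≅K⇒complete G≅K) x y))

  from : (∀ x y (y≠0 : y # 0#) → da G x y ≈ ((1# + x * y ^ 2) ^ n - 1#) / y [ y≠0 ]) → G ≅ K n
  from da≈ = complete⇒≅K (identity⇒order≡ {n} identityℕ) (identity⇒complete {n} identityℕ)
    where
    identityℕ : ∀ a b .{{_ : NonZero b}} →
                b ℕ.* daℕ a b ℕ.+ 1 ≡ (1 ℕ.+ a ℕ.* b ℕ.^ 2) ℕ.^ n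
    identityℕ = identity⇒identityℕ char0 {n} G λ x y y≠0 → ≈/⇒*+1≈ y≠0 (da≈ x y y≠0)
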